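{- Let $n\ge 3$ and let $C_n$ be the cycle on $n$ vertices. Then $$\tau(C_n)=\begin{cases}4 & \text{if } n\equiv 0 \pmod 4,\\ n & \text{if } n\equiv 1,3 \pmod 4,\\ \left(\frac n2\right)^2 & \text{if } n\equiv 2 \pmod 4.\end{cases}$$
   Context: A set $D \subseteq V(G)$ is a total dominating set of a graph $G$ if every vertex of $G$ has a neighbor in $D$. $\gamma_t(G)$ is the minimum cardinality of a total dominating set; a minimum one is a $\gamma_t(G)$-set, and $\tau(G)$ is the number of $\gamma_t(G)$-sets. -}

module Defs where

open import Data.Fin.Base using (Fin; toℕ)
open import Data.Fin.Properties using (all?; any?)
open import Data.Fin.Subset using (Subset; inside; outside; _∈_; ∣_∣)
open import Data.Fin.Subset.Properties using (_∈?_; anySubset?)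
open import Data.List.Base using (List; []; _∷_; [_]; _++_; map; filter; length)
open import Data.List.Membership.Propositional using () renaming (_∈_ to _∈ˡ_)
open import Data.List.Membership.Propositional.Properties
  using (∈-map⁺; ∈-map⁻; ∈-++⁺ˡ; ∈-++⁺ʳ)
open import Data.List.Relation.Unary.All using ([])
open import Data.List.Relation.Unary.Any using (here)
open import Data.List.Relation.Unary.AllPairs using ([]; _∷_)
open import Data.List.Relation.Unary.Unique.Propositional using (Unique)
open import Data.List.Relation.Unary.Unique.Propositional.Properties using (map⁺; ++⁺)
open import Data.Nat.Base using (ℕ; zero; suc; _≤_; s≤s)
open import Data.Nat.Properties using (_≟_; _<?_; ≮⇒≥; <⇒≱; 1+n≢n)
open import Data.Product.Base using (_×_; _,_; ∃-syntax)
open import Data.Sum.Base using (_⊎_; inj₁; inj₂; swap)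
open import Data.Vec.Base using ([]; _∷_)
open import Data.Vec.Properties using (∷-injectiveʳ)
open import Level using (0ℓ)
open import Relation.Binary.Core using (Rel)
open import Relation.Binary.Definitions using (Symmetric; Irreflexive; Decidable)
open import Relation.Binary.PropositionalEquality using (_≡_; refl; trans; sym; cong)
open import Relation.Nullary using (Dec; ¬_)
open import Relation.Nullary.Decidable using (_×-dec_; _⊎-dec_; ¬?; map′)

-- Finite simple graphs on the vertex set Fin n.
record Graph (n : ℕ) : Set₁ where
  field
    Adj    : Rel (Fin n) 0ℓ
    symm   : Symmetric Adj
    irrefl : Irreflexive _≡_ Adj
    adj?   : Decidable Adj

module _ {n : ℕ} (G : Graph n) where
  open Graph G

  IsTotalDominating : Subset n → Set
  IsTotalDominating D = ∀ v → ∃[ u ] Adj v u × u ∈ D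

  IsγₜSet : Subset n → Set
  IsγₜSet D = IsTotalDominating D × (∀ E → IsTotalDominating E → ∣ D ∣ ≤ ∣ E ∣)

  isTotalDominating? : ∀ D → Dec (IsTotalDominating D)
  isTotalDominating? D = all? λ v → any? λ u → adj? v u ×-dec (u ∈? D)

  isγₜSet? : ∀ D → Dec (IsγₜSet D)
  isγₜSet? D = isTotalDominating? D ×-dec
    map′ (λ none E tE → ≮⇒≥ λ E<D → none (E , tE , E<D))
         (λ { min (E , tE , E<D) → <⇒≱ E<D (min E tE) })
         (¬? (anySubset? λ E → isTotalDominating? E ×-dec (∣ E ∣ <? ∣ D ∣)))

-- Every subset occurs exactly once, by ∈-subsets and subsets-unique below.
subsets : ∀ n → List (Subset n)
subsets zero    = [ [] ]
subsets (suc n) = map (inside ∷_) (subsets n) ++ map (outside ∷_) (subsets n)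

∈-subsets : ∀ {n} (D : Subset n) → D ∈ˡ subsets n
∈-subsets []            = here refl
∈-subsets (inside  ∷ D) = ∈-++⁺ˡ (∈-map⁺ (inside ∷_) (∈-subsets D))
∈-subsets (outside ∷ D) =
  ∈-++⁺ʳ (map (inside ∷_) (subsets _)) (∈-map⁺ (outside ∷_) (∈-subsets D))

subsets-unique : ∀ n → Unique (subsets n)
subsets-unique zero    = [] ∷ []
subsets-unique (suc n) =
  ++⁺ (map⁺ ∷-injectiveʳ (subsets-unique n))
      (map⁺ ∷-injectiveʳ (subsets-unique n))
      disjoint
  where
  disjoint : ∀ {D} → ¬ (D ∈ˡ map (inside ∷_) (subsets n) ×
                        D ∈ˡ map (outside ∷_) (subsets n))
  disjoint (p , q) with ∈-map⁻ (inside ∷_) p | ∈-map⁻ (outside ∷_) q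
  ... | _ , _ , refl | _ , _ , ()

τ : ∀ {n} → Graph n → ℕ
τ {n} G = length (filter (isγₜSet? G) (subsets n))

-- j is the cyclic successor of i; the second summand is the step from n-1 to 0.
CyclicSuc : ∀ n → Rel (Fin n) 0ℓ
CyclicSuc n i j = toℕ j ≡ suc (toℕ i) ⊎ (suc (toℕ i) ≡ n × toℕ j ≡ 0)

cyclicSuc? : ∀ n → Decidable (CyclicSuc n)
cyclicSuc? n i j =
  (toℕ j ≟ suc (toℕ i)) ⊎-dec ((suc (toℕ i) ≟ n) ×-dec (toℕ j ≟ 0))

cyclicSuc-irrefl : ∀ {n} → 3 ≤ n → Irreflexive _≡_ (CyclicSuc n)
cyclicSuc-irrefl _   refl (inj₁ i≡1+i) = 1+n≢n (sym i≡1+i)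
cyclicSuc-irrefl 3≤n refl (inj₂ (1+i≡n , i≡0))
  with refl ← trans (sym 1+i≡n) (cong suc i≡0) | s≤s () ← 3≤n

cycle : ∀ n → 3 ≤ n → Graph n
cycle n 3≤n = record
  { Adj    = λ i j → CyclicSuc n i j ⊎ CyclicSuc n j i
  ; symm   = swap
  ; irrefl = λ { i≡j (inj₁ s) → cyclicSuc-irrefl 3≤n i≡j s
               ; i≡j (inj₂ s) → cyclicSuc-irrefl 3≤n (sym i≡j) s }
  ; adj?   = λ i j → cyclicSuc? n i j ⊎-dec cyclicSuc? n j i
  }

{-# OPTIONS --safe #-}
-- The neighbours of v are v − 1 and v + 1, so D is total dominating iff it is a vertex
-- cover of the graph joining vertices two steps apart: two cycles of length n / 2 if n
-- is even, one cycle of length n if n is odd (the word D₀ D₂ … Dₙ₋₁ D₁ D₃ … Dₙ₋₂).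
-- A cycle of length m has 2 minimum vertex covers if m is even and m if m is odd. Cut
-- at one vertex, these are covers of paths, counted by the recursion that a path cover
-- next to a chosen vertex starts with a chosen vertex or with an unchosen followed by a
-- chosen one; by parity, either both branches attain the minimum weight or only the second.
module Submission where

open import Defs
open import Data.Nat.Base using (ℕ; _≤_; _^_)
open import Data.Nat.DivMod using (_/_; _%_)
open import Data.Product.Base using (_×_)
open import Data.Sum.Base using (_⊎_)
open import Relation.Binary.PropositionalEquality using (_≡_)

open import Data.Bool.Base using (Bool; false; T; _∨_)
open import Data.Bool.Properties using (T-∨; T-≡)
open import Data.Fin.Base using (toℕ; fromℕ<) renaming (zero to fzero; suc to fsuc)
open import Data.Fin.Properties using (toℕ<n; toℕ-fromℕ<)
open import Data.Fin.Subset using (Subset; inside; outside; _∈_; ∣_∣)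
open import Data.List.Base as List using (List; []; _∷_; length; cartesianProduct)
open import Data.List.Membership.Propositional using () renaming (_∈_ to _∈ˡ_)
open import Data.List.Membership.Propositional.Properties
  using (∈-map⁺; ∈-map⁻; ∈-++⁺ˡ; ∈-++⁺ʳ; ∈-++⁻; ∈-filter⁺; ∈-filter⁻;
         ∈-cartesianProduct⁺; ∈-cartesianProduct⁻)
open import Data.List.Membership.Propositional.Properties.WithK using (unique∧set⇒bag)
open import Data.List.Properties using (length-map; length-++)
open import Data.List.Relation.Binary.BagAndSetEquality using (∼bag⇒↭)
open import Data.List.Relation.Binary.Permutation.Propositional.Properties using (↭-length)
open import Data.List.Relation.Unary.All using ([])
open import Data.List.Relation.Unary.AllPairs using ([]; _∷_)
open import Data.List.Relation.Unary.Any using (here)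
open import Data.List.Relation.Unary.Unique.Propositional using (Unique)
open import Data.List.Relation.Unary.Unique.Propositional.Properties
  using (map⁺; ++⁺; cartesianProduct⁺; filter⁺)
open import Data.Nat.Base using (zero; suc; _+_; _*_; _<_; s≤s; z≤n)
open import Data.Nat.DivMod using (m≡m%n+[m/n]*n; m*n/n≡m)
open import Data.Nat.Properties
open import Data.Product.Base using (_,_; proj₁; proj₂; ∃-syntax)
open import Data.Product.Properties using (×-≡,≡→≡)
open import Data.Sum.Base using (inj₁; inj₂; [_,_]′)
open import Data.Sum.Properties using (inj₁-injective; inj₂-injective)
open import Data.Unit.Base using (tt)
open import Data.Vec.Base using (Vec; []; _∷_; _++_; lookup; take; drop)
open import Data.Vec.Properties
  using (∷-injective; []=⇒lookup; lookup⇒[]=; take++drop≡id; ++-injective)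
open import Function.Base using (_∘_; id)
open import Function.Bundles using (_⇔_; mk⇔; Equivalence)
open import Relation.Binary.PropositionalEquality
  using (refl; sym; trans; cong; cong₂; subst; module ≡-Reasoning)
open import Relation.Nullary using (contradiction)
open Equivalence using (to; from)

-- Elements of least weight and their number.

-- For c = 0 the number w is only a strict lower bound of the weights.
record Minimised {A : Set} (P : A → Set) (wt : A → ℕ) (w c : ℕ) : Set where
  field
    minimisers : List A
    unique     : Unique minimisers
    sound      : ∀ {x} → x ∈ˡ minimisers → P x × wt x ≡ w
    complete   : ∀ {x} → P x → w < wt x ⊎ x ∈ˡ minimisers
    size       : length minimisers ≡ c

  lower : ∀ {x} → P x → w ≤ wt x
  lower p with complete p
  ... | inj₁ lt = <⇒≤ lt
  ... | inj₂ x∈ = ≤-reflexive (sym (proj₂ (sound x∈)))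

open Minimised

module _ {A B : Set} {P : A → Set} {Q : B → Set} {wt : A → ℕ} {wt′ : B → ℕ} where

  -- A constant shift of the weight preserves minimality. It suffices that `f` reaches the elements
  -- satisfying `Q`: `extend`, for instance, misses the words starting with two `outside`.
  image : ∀ {w c} s (f : A → B) → (∀ {x y} → f x ≡ f y → x ≡ y) →
          (∀ {y} → Q y → ∃[ x ] f x ≡ y) → (∀ x → P x ⇔ Q (f x)) →
          (∀ x → wt′ (f x) ≡ s + wt x) →
          Minimised P wt w c → Minimised Q wt′ (s + w) c
  image {w} s f f-inj f-surj P⇔Q wt≡ M = record
    { minimisers = List.map f (minimisers M)
    ; unique     = map⁺ f-inj (unique M)
    ; sound      = sound′
    ; complete   = complete′
    ; size       = trans (length-map f (minimisers M)) (size M)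
    }
    where
    sound′ : ∀ {y} → y ∈ˡ List.map f (minimisers M) → Q y × wt′ y ≡ s + w
    sound′ y∈ with x , x∈ , refl ← ∈-map⁻ f y∈ with Px , eq ← sound M x∈ =
      to (P⇔Q x) Px , trans (wt≡ x) (cong (s +_) eq)

    complete′ : ∀ {y} → Q y → s + w < wt′ y ⊎ y ∈ˡ List.map f (minimisers M)
    complete′ Qy with x , refl ← f-surj Qy with complete M (from (P⇔Q x) Qy)
    ... | inj₁ lt = inj₁ (subst (s + w <_) (sym (wt≡ x)) (+-monoʳ-< s lt))
    ... | inj₂ x∈ = inj₂ (∈-map⁺ f x∈)

  sum-= : ∀ {w c d} → Minimised P wt w c → Minimised Q wt′ w d →
          Minimised [ P , Q ]′ [ wt , wt′ ]′ w (c + d)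
  sum-= {w} M N = record
    { minimisers = ls List.++ rs
    ; unique     = ++⁺ (map⁺ inj₁-injective (unique M)) (map⁺ inj₂-injective (unique N))
                       λ (p , q) → disjoint p q
    ; sound      = λ z∈ → sound′ (∈-++⁻ ls z∈)
    ; complete   = λ {z} → complete′ z
    ; size       = trans (length-++ ls)
                     (cong₂ _+_ (trans (length-map inj₁ (minimisers M)) (size M))
                                (trans (length-map inj₂ (minimisers N)) (size N)))
    }
    where
    ls rs : List (A ⊎ B)
    ls = List.map inj₁ (minimisers M)
    rs = List.map inj₂ (minimisers N)

    disjoint : ∀ {z} → z ∈ˡ ls → z ∈ˡ rs → _
    disjoint p q with ∈-map⁻ inj₁ p | ∈-map⁻ inj₂ q
    ... | _ , _ , refl | _ , _ , ()

    sound′ : ∀ {z} → z ∈ˡ ls ⊎ z ∈ˡ rs → [ P , Q ]′ z × [ wt , wt′ ]′ z ≡ w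
    sound′ (inj₁ p) with _ , x∈ , refl ← ∈-map⁻ inj₁ p = sound M x∈
    sound′ (inj₂ q) with _ , y∈ , refl ← ∈-map⁻ inj₂ q = sound N y∈

    complete′ : ∀ z → [ P , Q ]′ z → w < [ wt , wt′ ]′ z ⊎ z ∈ˡ ls List.++ rs
    complete′ (inj₁ x) Px with complete M Px
    ... | inj₁ lt = inj₁ lt
    ... | inj₂ x∈ = inj₂ (∈-++⁺ˡ (∈-map⁺ inj₁ x∈))
    complete′ (inj₂ y) Qy with complete N Qy
    ... | inj₁ lt = inj₁ lt
    ... | inj₂ y∈ = inj₂ (∈-++⁺ʳ ls (∈-map⁺ inj₂ y∈))

  -- Everything admissible in the second summand weighs at least `v`, hence more than `w`, so only
  -- the minimisers of the first survive.
  sum-< : ∀ {w v c d} → w < v → Minimised P wt w c → Minimised Q wt′ v d →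
          Minimised [ P , Q ]′ [ wt , wt′ ]′ w c
  sum-< {w} {v} w<v M N = record
    { minimisers = List.map inj₁ (minimisers M)
    ; unique     = map⁺ inj₁-injective (unique M)
    ; sound      = sound′
    ; complete   = λ {z} → complete′ z
    ; size       = trans (length-map inj₁ (minimisers M)) (size M)
    }
    where
    sound′ : ∀ {z} → z ∈ˡ List.map inj₁ (minimisers M) →
             [ P , Q ]′ z × [ wt , wt′ ]′ z ≡ w
    sound′ p with _ , x∈ , refl ← ∈-map⁻ inj₁ p = sound M x∈

    complete′ : ∀ z → [ P , Q ]′ z →
                w < [ wt , wt′ ]′ z ⊎ z ∈ˡ List.map inj₁ (minimisers M)
    complete′ (inj₁ x) Px with complete M Px
    ... | inj₁ lt = inj₁ lt
    ... | inj₂ x∈ = inj₂ (∈-map⁺ inj₁ x∈)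
    complete′ (inj₂ y) Qy = inj₁ (<-≤-trans w<v (lower N Qy))

  -- Weights add, so a pair attains `w + v` only if both components are minimal: a strict excess in
  -- one is not offset by the other.
  product : ∀ {w v c d} → Minimised P wt w c → Minimised Q wt′ v d →
            Minimised (λ (x , y) → P x × Q y) (λ (x , y) → wt x + wt′ y) (w + v) (c * d)
  product {w} {v} M N = record
    { minimisers = cartesianProduct (minimisers M) (minimisers N)
    ; unique     = cartesianProduct⁺ (unique M) (unique N)
    ; sound      = sound′
    ; complete   = λ (Px , Qy) → complete′ Px Qy
    ; size       = trans (length-cartesianProduct (minimisers M) (minimisers N))
                         (cong₂ _*_ (size M) (size N))
    }
    where
    length-cartesianProduct : ∀ (xs : List A) (ys : List B) →
      length (cartesianProduct xs ys) ≡ length xs * length ys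
    length-cartesianProduct []       ys = refl
    length-cartesianProduct (x ∷ xs) ys = trans (length-++ (List.map (x ,_) ys))
      (cong₂ _+_ (length-map (x ,_) ys) (length-cartesianProduct xs ys))

    sound′ : ∀ {z} → z ∈ˡ cartesianProduct (minimisers M) (minimisers N) →
             (P (proj₁ z) × Q (proj₂ z)) × wt (proj₁ z) + wt′ (proj₂ z) ≡ w + v
    sound′ z∈ with x∈ , y∈ ← ∈-cartesianProduct⁻ (minimisers M) (minimisers N) z∈
              with Px , eq ← sound M x∈ | Qy , eq′ ← sound N y∈ =
      (Px , Qy) , cong₂ _+_ eq eq′

    complete′ : ∀ {x y} → P x → Q y → w + v < wt x + wt′ y ⊎
                (x , y) ∈ˡ cartesianProduct (minimisers M) (minimisers N)
    complete′ Px Qy with complete M Px | complete N Qy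
    ... | inj₁ lt | _       = inj₁ (+-mono-<-≤ lt (lower N Qy))
    ... | inj₂ _  | inj₁ lt = inj₁ (+-mono-≤-< (lower M Px) lt)
    ... | inj₂ x∈ | inj₂ y∈ = inj₂ (∈-cartesianProduct⁺ x∈ y∈)

-- The positive count supplies a minimiser `E`, so `w` is attained and no γₜ-set weighs more. Two
-- duplicate-free lists with the same members are permutations of each other, hence equally long.
τ-count : ∀ {n} (G : Graph n) {w c} →
          Minimised (IsTotalDominating G) ∣_∣ w (suc c) → τ G ≡ suc c
τ-count {n} G {w} M with minimisers M in eq | size M
... | E ∷ Es | refl = trans (↭-length (∼bag⇒↭ bag)) (cong length eq)
  where
  E∈ : E ∈ˡ minimisers M
  E∈ = subst (E ∈ˡ_) (sym eq) (here refl)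

  γₜ⇒∈ : ∀ {D} → IsγₜSet G D → D ∈ˡ minimisers M
  γₜ⇒∈ (tD , min) with complete M tD
  ... | inj₂ D∈ = D∈
  ... | inj₁ lt with tE , refl ← sound M E∈ = contradiction (min E tE) (<⇒≱ lt)

  ∈⇒γₜ : ∀ {D} → D ∈ˡ minimisers M → IsγₜSet G D
  ∈⇒γₜ D∈ with tD , refl ← sound M D∈ = tD , λ _ tF → lower M tF

  bag = unique∧set⇒bag (filter⁺ (isγₜSet? G) (subsets-unique n)) (unique M)
    (mk⇔ (γₜ⇒∈ ∘ proj₂ ∘ ∈-filter⁻ (isγₜSet? G) {xs = subsets n})
         (λ D∈ → ∈-filter⁺ (isγₜSet? G) (∈-subsets _) (∈⇒γₜ D∈)))

-- Minimum vertex covers of paths and cycles.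

-- Vertex covers of a path whose end vertices have the prescribed status a and b.
Covered : ∀ {k} → Bool → Vec Bool k → Bool → Set
Covered a []       b = T (a ∨ b)
Covered a (x ∷ xs) b = T (a ∨ x) × Covered x xs b

Covers : Bool → ℕ → ℕ → ℕ → Set
Covers b k = Minimised (λ (xs : Vec Bool k) → Covered inside xs b) ∣_∣

-- Either branch adds exactly one chosen vertex and leaves the remaining word next to a chosen
-- vertex, so the weight shift is the same for both.
extend : ∀ {k} → Vec Bool k ⊎ Vec Bool (1 + k) → Vec Bool (2 + k)
extend (inj₁ xs) = outside ∷ inside ∷ xs
extend (inj₂ ys) = inside ∷ ys

extend-injective : ∀ {k} {x y : Vec Bool k ⊎ Vec Bool (1 + k)} → extend x ≡ extend y → x ≡ y
extend-injective {x = inj₁ _} {inj₁ _} refl = refl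
extend-injective {x = inj₂ _} {inj₂ _} refl = refl

extend-∣∣ : ∀ {k} (z : Vec Bool k ⊎ Vec Bool (1 + k)) →
            ∣ extend z ∣ ≡ 1 + [ ∣_∣ , ∣_∣ ]′ z
extend-∣∣ (inj₁ _) = refl
extend-∣∣ (inj₂ _) = refl

module _ {b : Bool} where

  module _ {k : ℕ} where
    ExtensionCovered : Vec Bool k ⊎ Vec Bool (1 + k) → Set
    ExtensionCovered = [ (λ xs → Covered inside xs b) , (λ ys → Covered inside ys b) ]′

    covers-extend : ∀ {w c} → Minimised ExtensionCovered [ ∣_∣ , ∣_∣ ]′ w c →
                    Covers b (2 + k) (1 + w) c
    covers-extend = image 1 extend extend-injective extend-surjective extend-covered extend-∣∣
      where
      extend-surjective : ∀ {zs} → Covered inside zs b → ∃[ z ] extend z ≡ zs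
      -- Words starting with two `outside` drop out, as the edge between these vertices is
      -- uncovered.
      extend-surjective {outside ∷ inside ∷ xs} _ = inj₁ xs , refl
      extend-surjective {inside ∷ ys}           _ = inj₂ ys , refl

      extend-covered : ∀ z → ExtensionCovered z ⇔ Covered inside (extend z) b
      extend-covered (inj₁ _) = mk⇔ (λ p → tt , tt , p) (proj₂ ∘ proj₂)
      extend-covered (inj₂ _) = mk⇔ (tt ,_) proj₂

  step-= : ∀ {k w c d} → Covers b k w c → Covers b (1 + k) w d →
           Covers b (2 + k) (1 + w) (d + c)
  step-= {c = c} {d} M N =
    -- With `d` first, the instance `d = 1` computes to a successor, as the counts `suc j` below
    -- require.
    subst (Covers b _ _) (+-comm c d) (covers-extend (sum-= M N))

  step-< : ∀ {k w c d} → Covers b k w c → Covers b (1 + k) (1 + w) d →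
           Covers b (2 + k) (1 + w) c
  step-< M N = covers-extend (sum-< (n<1+n _) M N)

  -- The only edge is covered by the chosen left end, whatever `b` is.
  covers-empty : Covers b 0 0 1
  covers-empty = record
    { minimisers = [] List.∷ []
    ; unique     = [] ∷ []
    ; sound      = λ { (here refl) → tt , refl }
    ; complete   = λ { {[]} _ → inj₂ (here refl) }
    ; size       = refl
    }

-- Chosen ends put no constraint on the path. An even path splits into `j` matching edges, each
-- using one vertex; the choice passes from right to left vertices at most once, which leaves
-- `suc j` covers. On an odd path only the choice of every second vertex, starting with the second,
-- has weight `j`.
covers-inside-even : ∀ j → Covers inside (j * 2) j (suc j)
covers-inside-odd  : ∀ j → Covers inside (1 + j * 2) j 1
covers-inside-even zero    = covers-empty
covers-inside-even (suc j) = step-= (covers-inside-even j) (covers-inside-odd j)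
covers-inside-odd zero = record
  { minimisers = (outside ∷ []) List.∷ []
  ; unique     = [] ∷ []
  ; sound      = λ { (here refl) → (tt , tt) , refl }
  ; complete   = λ { {outside ∷ []} _ → inj₂ (here refl)
                   ; {inside ∷ []} _ → inj₁ (s≤s z≤n) }
  ; size       = refl
  }
covers-inside-odd (suc j) = step-< (covers-inside-odd j) (covers-inside-even (suc j))

-- The unchosen right end forces the last vertex of a nonempty path; what precedes it is a path
-- between chosen ends, shorter by one, so the parities trade places.
covers-outside-even : ∀ j → Covers outside (j * 2) j 1
covers-outside-odd  : ∀ j → Covers outside (1 + j * 2) (suc j) (suc j)
covers-outside-even zero    = covers-empty
covers-outside-even (suc j) = step-< (covers-outside-even j) (covers-outside-odd j)
covers-outside-odd zero = record
  { minimisers = (inside ∷ []) List.∷ []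
  ; unique     = [] ∷ []
  ; sound      = λ { (here refl) → (tt , tt) , refl }
  ; complete   = λ { {inside ∷ []} _ → inj₂ (here refl)
                   ; {outside ∷ []} (_ , ()) }
  ; size       = refl
  }
covers-outside-odd (suc j) = step-= (covers-outside-odd j) (covers-outside-even (suc j))

CyclicallyCovered : ∀ {k} → Vec Bool (suc k) → Set
CyclicallyCovered (x ∷ xs) = Covered x xs x

CyclicCovers : ℕ → ℕ → ℕ → Set
CyclicCovers k = Minimised (CyclicallyCovered {k}) ∣_∣

-- An unchosen head forces its successor and leaves `k` vertices up to the unchosen head again; a
-- chosen head leaves `1 + k` vertices between chosen ends. Either case costs one chosen vertex, so
-- `extend` serves here too.
cyclicCovers : ∀ {k w c d} → Covers outside k w c → Covers inside (1 + k) w d →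
               CyclicCovers (1 + k) (1 + w) (c + d)
cyclicCovers M N =
  image 1 extend extend-injective extend-surjective extend-covered extend-∣∣ (sum-= M N)
  where
  extend-surjective : ∀ {k} {zs : Vec Bool (2 + k)} → CyclicallyCovered zs → ∃[ z ] extend z ≡ zs
  extend-surjective {zs = outside ∷ inside ∷ xs} _ = inj₁ xs , refl
  extend-surjective {zs = inside ∷ ys}           _ = inj₂ ys , refl

  extend-covered : ∀ {k} (z : Vec Bool k ⊎ Vec Bool (1 + k)) →
    [ (λ xs → Covered inside xs outside) , (λ ys → Covered inside ys inside) ]′ z ⇔
    CyclicallyCovered (extend z)
  extend-covered (inj₁ _) = mk⇔ (tt ,_) proj₂
  extend-covered (inj₂ _) = mk⇔ id id

-- The minimisers are the two alternating choices; the cycle has `2 + j * 2` vertices, one more than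
-- the index.
cyclicCovers-even : ∀ j → CyclicCovers (1 + j * 2) (suc j) 2
cyclicCovers-even j = cyclicCovers (covers-outside-even j) (covers-inside-odd j)

m*2≡m+m : ∀ m → m * 2 ≡ m + m
m*2≡m+m m = trans (*-comm m 2) (cong (m +_) (+-identityʳ m))

-- A minimum cover of an odd cycle alternates except at one adjacent chosen pair, whose position is
-- free, hence as many covers as vertices.
cyclicCovers-odd : ∀ j → CyclicCovers (2 + j * 2) (2 + j) (3 + j * 2)
cyclicCovers-odd j = subst (CyclicCovers _ _)
  (cong suc (trans (+-comm j (2 + j)) (cong (2 +_) (sym (m*2≡m+m j)))))
  (cyclicCovers (covers-outside-odd j) (covers-inside-even (suc j)))

-- Total domination of a cycle as covering of positions two apart.

-- `a`, `b` precede the word and `c`, `d` follow it; taking `c`, `d` equal to `a`, `b` closes it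
-- into a cycle.
StrideCovered : ∀ {k} → Bool → Bool → Vec Bool k → Bool → Bool → Set
StrideCovered a b []       c d = T (a ∨ c) × T (b ∨ d)
StrideCovered a b (x ∷ xs) c d = T (a ∨ x) × StrideCovered b x xs c d

-- Indices in `ℕ` allow `i` and `2 + i` without bound proofs; the default `false` covers nothing.
at : ∀ {n} → Vec Bool n → ℕ → Bool
at []       _       = false
at (x ∷ xs) zero    = x
at (x ∷ xs) (suc i) = at xs i

at-++ˡ : ∀ {m n} (xs : Vec Bool m) {ys : Vec Bool n} {i} → i < m →
         at (xs ++ ys) i ≡ at xs i
at-++ˡ (x ∷ xs) {i = zero}  _       = refl
at-++ˡ (x ∷ xs) {i = suc i} (s≤s p) = at-++ˡ xs p

at-++ʳ : ∀ {m n} (xs : Vec Bool m) {ys : Vec Bool n} i → at (xs ++ ys) (m + i) ≡ at ys i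
at-++ʳ []       i = refl
at-++ʳ (x ∷ xs) i = at-++ʳ xs i

at-toℕ : ∀ {n} (xs : Vec Bool n) u → at xs (toℕ u) ≡ lookup xs u
at-toℕ (x ∷ xs) fzero    = refl
at-toℕ (x ∷ xs) (fsuc u) = at-toℕ xs u

strideCovered⇒at : ∀ {k} a b (xs : Vec Bool k) {c d} → StrideCovered a b xs c d →
  let w = a ∷ b ∷ xs ++ c ∷ d ∷ [] in ∀ i → i < 2 + k → T (at w i ∨ at w (2 + i))
strideCovered⇒at a b []       (p , q) zero          _         = p
strideCovered⇒at a b []       (p , q) (suc zero)    _         = q
strideCovered⇒at a b []       _       (suc (suc _)) (s≤s (s≤s ()))
strideCovered⇒at a b (x ∷ xs) (p , q) zero          _         = p
strideCovered⇒at a b (x ∷ xs) (p , q) (suc i)       (s≤s i<n) = strideCovered⇒at b x xs q i i<n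

at⇒strideCovered : ∀ {k} a b (xs : Vec Bool k) {c d} →
  (let w = a ∷ b ∷ xs ++ c ∷ d ∷ [] in ∀ i → i < 2 + k → T (at w i ∨ at w (2 + i))) →
  StrideCovered a b xs c d
at⇒strideCovered a b []       h = h 0 (s≤s z≤n) , h 1 (s≤s (s≤s z≤n))
at⇒strideCovered a b (x ∷ xs) h =
  h 0 (s≤s z≤n) , at⇒strideCovered b x xs (λ i i<n → h (suc i) (s≤s i<n))

module _ {k} (3≤n : 3 ≤ 2 + k) (a b : Bool) (xs : Vec Bool k) where
  private
    n = 2 + k

    D : Vec Bool n
    D = a ∷ b ∷ xs

    -- Repeating the first two entries turns the cyclic condition into a linear one, without modular
    -- arithmetic.
    w : Vec Bool (n + 2)
    w = D ++ a ∷ b ∷ []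

    last : ∃[ u ] suc (toℕ {n} u) ≡ n
    last = fromℕ< (n<1+n (1 + k)) , cong suc (toℕ-fromℕ< (n<1+n (1 + k)))

    at-w : ∀ u → at w (toℕ u) ≡ lookup D u
    at-w u = trans (at-++ˡ D (toℕ<n u)) (at-toℕ D u)

    ∈⇒at : ∀ {u i} → toℕ u ≡ i → u ∈ D → T (at w i)
    ∈⇒at {u} refl u∈ = from T-≡ (trans (at-w u) ([]=⇒lookup u∈))

    at⇒∈ : ∀ {u i} → toℕ u ≡ i → T (at w i) → u ∈ D
    at⇒∈ {u} refl p = lookup⇒[]= u D (trans (sym (at-w u)) (to T-≡ p))

    at-wrap₀ : at w n ≡ at w 0
    at-wrap₀ = trans (cong (at w) (sym (+-identityʳ n))) (at-++ʳ D 0)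

    at-wrap₁ : at w (1 + n) ≡ at w 1
    at-wrap₁ = trans (cong (at w) (+-comm 1 n)) (at-++ʳ D 1)

    Windows : Set
    Windows = ∀ i → i < n → T (at w i ∨ at w (2 + i))

    -- The window at `i` holds the two neighbours of vertex `1 + i`. If that vertex is the last one,
    -- its right neighbour is vertex 0, read at position `n`.
    window-inner : IsTotalDominating (cycle n 3≤n) D →
                   ∀ {i v} → toℕ {n} v ≡ suc i → T (at w i) ⊎ T (at w (2 + i))
    window-inner td {i} {v} v≡ with td v
    ... | u , inj₁ (inj₁ u≡) , u∈ = inj₂ (∈⇒at (trans u≡ (cong suc v≡)) u∈)
    ... | u , inj₁ (inj₂ (v≡n , u≡0)) , u∈ = inj₂ (subst T
            (trans (sym at-wrap₀) (cong (at w) (trans (sym v≡n) (cong suc v≡))))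
            (∈⇒at u≡0 u∈))
    ... | u , inj₂ (inj₁ v≡u) , u∈ = inj₁ (∈⇒at (suc-injective (trans (sym v≡u) v≡)) u∈)
    ... | u , inj₂ (inj₂ (_ , v≡0)) , _ with () ← trans (sym v≡0) v≡

    -- This window is centred on vertex 0: its neighbours are the last vertex and vertex 1, the
    -- latter read at position `1 + n`.
    window-outer : IsTotalDominating (cycle n 3≤n) D → T (at w (1 + k)) ⊎ T (at w (1 + n))
    window-outer td with td fzero
    ... | u , inj₁ (inj₁ u≡1) , u∈ = inj₂ (subst T (sym at-wrap₁) (∈⇒at u≡1 u∈))
    ... | u , inj₂ (inj₂ (u≡ , _)) , u∈ = inj₁ (∈⇒at (suc-injective u≡) u∈)

    ⇒windows : IsTotalDominating (cycle n 3≤n) D → Windows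
    ⇒windows td i i<n with m≤n⇒m<n∨m≡n i<n
    ... | inj₁ 1+i<n = from T-∨ (window-inner td (toℕ-fromℕ< 1+i<n))
    ... | inj₂ refl  = from T-∨ (window-outer td)

    windows⇒ : Windows → IsTotalDominating (cycle n 3≤n) D
    windows⇒ h fzero with to T-∨ (h (1 + k) (n<1+n _))
    ... | inj₁ p = proj₁ last , inj₂ (inj₂ (proj₂ last , refl)) ,
                   at⇒∈ (suc-injective (proj₂ last)) p
    ... | inj₂ p = fsuc fzero , inj₁ (inj₁ refl) , at⇒∈ refl (subst T at-wrap₁ p)
    -- The window centred on `v` starts at `toℕ i`; the case split tells whether the right neighbour
    -- wraps to vertex 0.
    windows⇒ h v@(fsuc i) = go (to T-∨ (h (toℕ i) i<n)) (m≤n⇒m<n∨m≡n (toℕ<n v))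
      where
      i<n : toℕ i < n
      i<n = <-trans (n<1+n _) (toℕ<n v)

      go : T (at w (toℕ i)) ⊎ T (at w (2 + toℕ i)) → 2 + toℕ i < n ⊎ 2 + toℕ i ≡ n → _
      go (inj₁ p) _            = fromℕ< i<n , inj₂ (inj₁ (cong suc (sym (toℕ-fromℕ< i<n)))) ,
                                 at⇒∈ (toℕ-fromℕ< i<n) p
      go (inj₂ p) (inj₁ 2+i<n) = fromℕ< 2+i<n , inj₁ (inj₁ (toℕ-fromℕ< 2+i<n)) ,
                                 at⇒∈ (toℕ-fromℕ< 2+i<n) p
      go (inj₂ p) (inj₂ 2+i≡n) = fzero , inj₁ (inj₂ (2+i≡n , refl)) ,
                                 at⇒∈ refl (subst T (trans (cong (at w) 2+i≡n) at-wrap₀) p)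

  totalDominating⇔ : IsTotalDominating (cycle n 3≤n) D ⇔ StrideCovered a b xs a b
  totalDominating⇔ =
    mk⇔ (at⇒strideCovered a b xs ∘ ⇒windows) (windows⇒ ∘ strideCovered⇒at a b xs)

-- Splitting a word into its even and odd positions.

-- The length is `m * 2` because this unfolds by two at each successor.
interleave : ∀ {m} → Vec Bool m → Vec Bool m → Vec Bool (m * 2)
interleave []       []       = []
interleave (x ∷ xs) (y ∷ ys) = x ∷ y ∷ interleave xs ys

interleave-injective : ∀ {m} (ws xs ys zs : Vec Bool m) →
  interleave ws xs ≡ interleave ys zs → ws ≡ ys × xs ≡ zs
interleave-injective []       []       []       []       _  = refl , refl
interleave-injective (w ∷ ws) (x ∷ xs) (y ∷ ys) (z ∷ zs) eq
  with refl , eq′ ← ∷-injective eq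
  with refl , eq″ ← ∷-injective eq′
  with refl , refl ← interleave-injective ws xs ys zs eq″ = refl , refl

interleave-surjective : ∀ m (zs : Vec Bool (m * 2)) → ∃[ xs ] ∃[ ys ] interleave {m} xs ys ≡ zs
interleave-surjective zero    []           = [] , [] , refl
interleave-surjective (suc m) (x ∷ y ∷ zs) with xs , ys , refl ← interleave-surjective m zs =
  x ∷ xs , y ∷ ys , refl

∣interleave∣ : ∀ {m} (xs ys : Vec Bool m) → ∣ interleave xs ys ∣ ≡ ∣ xs ∣ + ∣ ys ∣
∣interleave∣ []             []             = refl
∣interleave∣ (outside ∷ xs) (outside ∷ ys) = ∣interleave∣ xs ys
∣interleave∣ (inside  ∷ xs) (outside ∷ ys) = cong suc (∣interleave∣ xs ys)
∣interleave∣ (outside ∷ xs) (inside  ∷ ys) =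
  trans (cong suc (∣interleave∣ xs ys)) (sym (+-suc _ _))
∣interleave∣ (inside  ∷ xs) (inside  ∷ ys) =
  cong suc (trans (cong suc (∣interleave∣ xs ys)) (sym (+-suc _ _)))

∣++∣ : ∀ {m n} (xs : Vec Bool m) (ys : Vec Bool n) → ∣ xs ++ ys ∣ ≡ ∣ xs ∣ + ∣ ys ∣
∣++∣ []             ys = refl
∣++∣ (outside ∷ xs) ys = ∣++∣ xs ys
∣++∣ (inside  ∷ xs) ys = cong suc (∣++∣ xs ys)

-- Positions two apart have equal parity, so they are consecutive within one of the two words.
strideCovered-interleave : ∀ {m} {a b c d} (xs ys : Vec Bool m) →
  StrideCovered a b (interleave xs ys) c d ⇔ (Covered a xs c × Covered b ys d)
strideCovered-interleave []       []       = mk⇔ id id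
strideCovered-interleave (x ∷ xs) (y ∷ ys) =
  mk⇔ (λ (p , q , r) → let r₁ , r₂ = to ih r in (p , r₁) , (q , r₂))
      (λ ((p , r₁) , (q , r₂)) → p , q , from ih (r₁ , r₂))
  where ih = strideCovered-interleave xs ys

covered-++ : ∀ {m n} {a b c} (xs : Vec Bool m) {ys : Vec Bool n} →
  Covered a (xs ++ b ∷ ys) c ⇔ (Covered a xs b × Covered b ys c)
covered-++ []       = mk⇔ id id
covered-++ (x ∷ xs) = mk⇔ (λ (p , q) → let q₁ , q₂ = to ih q in (p , q₁) , q₂)
                          (λ ((p , q₁) , q₂) → p , from ih (q₁ , q₂))
  where ih = covered-++ xs

-- The numbers of minimum total dominating sets for even and odd order.

-- The order is a variable n because a conversion check of τ between two different
-- closed forms of the order would unfold the enumeration of all subsets.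
τ-even : ∀ {n} m (3≤n : 3 ≤ n) → n ≡ suc m * 2 → ∀ {w c} → CyclicCovers m w (suc c) →
         τ (cycle n 3≤n) ≡ suc c * suc c
τ-even m 3≤n refl M = τ-count (cycle (suc m * 2) 3≤n)
  (image 0 f f-injective f-surjective f-dominating (λ (xs , ys) → ∣interleave∣ xs ys)
         (product M M))
  where
  f : Vec Bool (suc m) × Vec Bool (suc m) → Subset (suc m * 2)
  f (xs , ys) = interleave xs ys

  f-injective : ∀ {x y} → f x ≡ f y → x ≡ y
  f-injective {ws , xs} {ys , zs} eq = ×-≡,≡→≡ (interleave-injective ws xs ys zs eq)

  f-surjective : ∀ {D} → IsTotalDominating (cycle (suc m * 2) 3≤n) D → ∃[ z ] f z ≡ D
  f-surjective {D} _ with xs , ys , eq ← interleave-surjective (suc m) D = (xs , ys) , eq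

  f-dominating : ∀ z → (CyclicallyCovered (proj₁ z) × CyclicallyCovered (proj₂ z)) ⇔
                       IsTotalDominating (cycle (suc m * 2) 3≤n) (f z)
  f-dominating (a ∷ xs , b ∷ ys) = mk⇔ (from td ∘ from sc) (to sc ∘ to td)
    where
    td = totalDominating⇔ 3≤n a b (interleave xs ys)
    sc = strideCovered-interleave xs ys

τ-odd : ∀ {n} m (3≤n : 3 ≤ n) → n ≡ 3 + m * 2 → τ (cycle n 3≤n) ≡ n
τ-odd m 3≤n refl = τ-count G (image 0 f f-injective f-surjective f-dominating f-∣∣
  -- The tail length `k * 2` becomes `k + k` so that `take k` and `drop k` halve it.
  (subst (λ l → CyclicCovers l (2 + m) (3 + m * 2)) (m*2≡m+m k) (cyclicCovers-odd m)))
  where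
  k = suc m
  G = cycle (3 + m * 2) 3≤n

  -- The first half of the tail goes to positions 2, 4, ..., the second half to 1, 3, ....
  f : Vec Bool (1 + (k + k)) → Subset (1 + k * 2)
  f (a ∷ zs) = a ∷ interleave (drop k zs) (take k zs)

  f-++ : ∀ a (xs ys : Vec Bool k) → f (a ∷ xs ++ ys) ≡ a ∷ interleave ys xs
  f-++ a xs ys with eq , eq′ ← ++-injective _ xs (take++drop≡id k (xs ++ ys)) =
    cong (a ∷_) (cong₂ interleave eq′ eq)

  f-injective : ∀ {x y} → f x ≡ f y → x ≡ y
  f-injective {a ∷ ws} {b ∷ zs} eq with refl , eq′ ← ∷-injective eq
    with eq₁ , eq₂ ← interleave-injective (drop k ws) (take k ws) (drop k zs) (take k zs) eq′ =
    cong (a ∷_) (trans (sym (take++drop≡id k ws))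
                (trans (cong₂ _++_ eq₂ eq₁) (take++drop≡id k zs)))

  f-surjective : ∀ {D} → IsTotalDominating G D → ∃[ z ] f z ≡ D
  f-surjective {a ∷ D} _ with ys , xs , refl ← interleave-surjective k D =
    a ∷ xs ++ ys , f-++ a xs ys

  -- For odd order two steps from the last vertex lead to vertex 1, and two steps from the last odd
  -- position lead to vertex 0. So the even positions run into `b`, the odd ones into `a`, and
  -- `covered-++` joins them at `b`.
  covered⇔ : ∀ a (xs ys : Vec Bool k) →
    Covered a (xs ++ ys) a ⇔ IsTotalDominating G (a ∷ interleave ys xs)
  covered⇔ a (e ∷ xs) (b ∷ ys) =
    mk⇔ (λ (p , q) → let q₁ , q₂ = to cv q in from td (p , from sc (q₂ , q₁)))
        (λ t → let p , q = to td t ; q₁ , q₂ = to sc q in p , from cv (q₂ , q₁))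
    where
    td = totalDominating⇔ 3≤n a b (e ∷ interleave ys xs)
    sc = strideCovered-interleave ys xs
    cv = covered-++ xs

  f-dominating : ∀ z → CyclicallyCovered z ⇔ IsTotalDominating G (f z)
  f-dominating (a ∷ zs) =
    subst (λ ws → Covered a ws a ⇔ IsTotalDominating G (f (a ∷ zs)))
          (take++drop≡id k zs) (covered⇔ a (take k zs) (drop k zs))

  ∣interleave∣≡ : ∀ (zs : Vec Bool (k + k)) → ∣ interleave (drop k zs) (take k zs) ∣ ≡ ∣ zs ∣
  ∣interleave∣≡ zs = begin
    ∣ interleave (drop k zs) (take k zs) ∣ ≡⟨ ∣interleave∣ (drop k zs) (take k zs) ⟩
    ∣ drop k zs ∣ + ∣ take k zs ∣          ≡⟨ +-comm ∣ drop k zs ∣ ∣ take k zs ∣ ⟩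
    ∣ take k zs ∣ + ∣ drop k zs ∣          ≡⟨ ∣++∣ (take k zs) (drop k zs) ⟨
    ∣ take k zs ++ drop k zs ∣             ≡⟨ cong ∣_∣ (take++drop≡id k zs) ⟩
    ∣ zs ∣                                 ∎
    where open ≡-Reasoning

  f-∣∣ : ∀ z → ∣ f z ∣ ≡ ∣ z ∣
  f-∣∣ (outside ∷ zs) = ∣interleave∣≡ zs
  f-∣∣ (inside  ∷ zs) = cong suc (∣interleave∣≡ zs)

-- The residues modulo 4.

-- Writing 4 as two factors 2 yields terms that compute to the order shapes of `τ-even` and `τ-odd`.
quotient : ∀ n {r} → n % 4 ≡ r → n ≡ r + n / 4 * 2 * 2
quotient n refl =
  trans (m≡m%n+[m/n]*n n 4) (cong (n % 4 +_) (sym (*-assoc (n / 4) 2 2)))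

theorem4p1 : (n : ℕ) (3≤n : 3 ≤ n) →
    (n % 4 ≡ 0 → τ (cycle n 3≤n) ≡ 4) ×
    (n % 4 ≡ 1 ⊎ n % 4 ≡ 3 → τ (cycle n 3≤n) ≡ n) ×
    (n % 4 ≡ 2 → τ (cycle n 3≤n) ≡ (n / 2) ^ 2)
theorem4p1 n 3≤n =
  (λ eq → residue-0 (n / 4) (quotient n eq)) ,
  [ (λ eq → residue-1 (n / 4) (quotient n eq)) ,
    (λ eq → τ-odd (n / 4 * 2) 3≤n (quotient n eq)) ]′ ,
  (λ eq → residue-2 (n / 4) (quotient n eq))
  where
  residue-0 : ∀ q → n ≡ q * 2 * 2 → τ (cycle n 3≤n) ≡ 4
  residue-0 zero    eq with () ← subst (3 ≤_) eq 3≤n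
  -- Both half-length cycles are even, with two covers each.
  residue-0 (suc q) eq = τ-even (1 + q * 2) 3≤n eq (cyclicCovers-even q)

  residue-1 : ∀ q → n ≡ 1 + q * 2 * 2 → τ (cycle n 3≤n) ≡ n
  residue-1 zero    eq with s≤s () ← subst (3 ≤_) eq 3≤n
  residue-1 (suc q) eq = τ-odd (1 + q * 2) 3≤n eq

  residue-2 : ∀ q → n ≡ 2 + q * 2 * 2 → τ (cycle n 3≤n) ≡ (n / 2) ^ 2
  residue-2 zero    eq with s≤s (s≤s ()) ← subst (3 ≤_) eq 3≤n
  -- Both cycles have odd length `h`, half of `n`, and so `h` covers each.
  residue-2 (suc q) eq = begin
    τ (cycle n 3≤n) ≡⟨ τ-even (2 + q * 2) 3≤n eq (cyclicCovers-odd q) ⟩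
    h * h           ≡⟨ cong (h *_) (*-identityʳ h) ⟨
    h ^ 2           ≡⟨ cong (_^ 2) (m*n/n≡m h 2) ⟨
    (h * 2 / 2) ^ 2 ≡⟨ cong (λ m → (m / 2) ^ 2) eq ⟨
    (n / 2) ^ 2     ∎
    where
    open ≡-Reasoning
    h = 3 + q * 2
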